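{- Let $p\geq 2$ and let $G$ be a finite simple $\{pK_2, K_1+C_4\}$-free graph. Then $\chi(G)\leq f_p(\omega(G))$, where $f_p:\mathbb{N}\to\mathbb{N}$ ($p\geq2$) is defined by: $f_t(1)=1$ for $t\geq 2$; $f_2(s)=s+1$ for $s\geq 2$; $f_p(2)=2p-2$ for $p\geq 3$; and $f_p(m)=\left(\sum_{j=2}^{m} f_{p-1}(j)\right)+f_{p-1}(m-1)+1$ for $m,p\geq 3$.
   Context: $\chi(G)$ is the chromatic number and $\omega(G)$ the clique number of $G$. $pK_2$ is the disjoint union of $p$ edges. $K_1+C_4$ is the wheel on five vertices: a $4$-cycle plus a vertex adjacent to all four of its vertices. A graph is $\mathcal{F}$-free if it has no induced subgraph isomorphic to a member of $\mathcal{F}$. -}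

module Defs where

open import Data.Nat using (ℕ; zero; suc; _+_; _*_; _∸_)
open import Data.Fin using (Fin; zero; suc)
open import Data.Bool using (Bool; true; false; _∧_; _xor_)
open import Data.Product using (Σ; _×_; _,_; ∃-syntax)
open import Relation.Binary.PropositionalEquality using (_≡_; _≢_)
open import Relation.Nullary using (¬_)
open import Function.Definitions using (Injective)

record SimpleGraph (V : Set) : Set where
  field
    adj   : V → V → Bool
    sym   : ∀ u v → adj u v ≡ adj v u
    irrefl : ∀ v → adj v v ≡ false
open SimpleGraph public

FinGraph : ℕ → Set
FinGraph n = SimpleGraph (Fin n)

InducedSub : {W V : Set} → SimpleGraph W → SimpleGraph V → Set
InducedSub {W} {V} H G =
  Σ (W → V) λ φ → Injective _≡_ _≡_ φ × (∀ a b → adj G (φ a) (φ b) ≡ adj H a b)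

pK2 : (p : ℕ) → SimpleGraph (Fin p × Bool)
pK2 p = record { adj = a ; sym = s ; irrefl = ir }
  where
  eqF : ∀ {k} → Fin k → Fin k → Bool
  eqF zero zero = true
  eqF zero (suc _) = false
  eqF (suc _) zero = false
  eqF (suc i) (suc j) = eqF i j
  eqF-sym : ∀ {k} (i j : Fin k) → eqF i j ≡ eqF j i
  eqF-sym zero zero = _≡_.refl
  eqF-sym zero (suc _) = _≡_.refl
  eqF-sym (suc _) zero = _≡_.refl
  eqF-sym (suc i) (suc j) = eqF-sym i j
  a : Fin p × Bool → Fin p × Bool → Bool
  a (i , x) (j , y) = eqF i j ∧ (x xor y)
  s : ∀ u v → a u v ≡ a v u
  s (i , false) (j , false) rewrite eqF-sym i j = _≡_.refl
  s (i , false) (j , true) rewrite eqF-sym i j = _≡_.refl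
  s (i , true) (j , false) rewrite eqF-sym i j = _≡_.refl
  s (i , true) (j , true) rewrite eqF-sym i j = _≡_.refl
  ir : ∀ v → a v v ≡ false
  ir (i , false) with eqF i i
  ... | true = _≡_.refl
  ... | false = _≡_.refl
  ir (i , true) with eqF i i
  ... | true = _≡_.refl
  ... | false = _≡_.refl

-- K₁ + C₄ (the 5-vertex wheel): vertex 0 is the hub,
-- vertices 1,2,3,4 form the 4-cycle 1-2-3-4-1.
private
  w : Fin 5 → Fin 5 → Bool
  w zero zero = false
  w zero (suc _) = true
  w (suc _) zero = true
  w (suc i) (suc j) = c i j
    where
    c : Fin 4 → Fin 4 → Bool
    c zero (suc zero) = true
    c (suc zero) zero = true
    c (suc zero) (suc (suc zero)) = true
    c (suc (suc zero)) (suc zero) = true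
    c (suc (suc zero)) (suc (suc (suc zero))) = true
    c (suc (suc (suc zero))) (suc (suc zero)) = true
    c (suc (suc (suc zero))) zero = true
    c zero (suc (suc (suc zero))) = true
    c _ _ = false

  Fin5 : (Fin 5 → Set) → Set
  Fin5 P = P zero × P (suc zero) × P (suc (suc zero)) × P (suc (suc (suc zero)))
           × P (suc (suc (suc (suc zero))))

  allF : ∀ {P : Fin 5 → Set} → Fin5 P → ∀ i → P i
  allF (a , _) zero = a
  allF (_ , b , _) (suc zero) = b
  allF (_ , _ , c , _) (suc (suc zero)) = c
  allF (_ , _ , _ , d , _) (suc (suc (suc zero))) = d
  allF (_ , _ , _ , _ , e) (suc (suc (suc (suc zero)))) = e

  wsym : ∀ u v → w u v ≡ w v u
  wsym u = allF {λ u → ∀ v → w u v ≡ w v u}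
    ( allF (_≡_.refl , _≡_.refl , _≡_.refl , _≡_.refl , _≡_.refl)
    , allF (_≡_.refl , _≡_.refl , _≡_.refl , _≡_.refl , _≡_.refl)
    , allF (_≡_.refl , _≡_.refl , _≡_.refl , _≡_.refl , _≡_.refl)
    , allF (_≡_.refl , _≡_.refl , _≡_.refl , _≡_.refl , _≡_.refl)
    , allF (_≡_.refl , _≡_.refl , _≡_.refl , _≡_.refl , _≡_.refl) ) u

  wirr : ∀ v → w v v ≡ false
  wirr = allF (_≡_.refl , _≡_.refl , _≡_.refl , _≡_.refl , _≡_.refl)

K1+C4 : SimpleGraph (Fin 5)
K1+C4 = record { adj = w ; sym = wsym ; irrefl = wirr }

HasClique : {V : Set} → SimpleGraph V → ℕ → Set
HasClique {V} G k =
  Σ (Fin k → V) λ φ → Injective _≡_ _≡_ φ × (∀ i j → i ≢ j → adj G (φ i) (φ j) ≡ true)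

IsCliqueNumber : {V : Set} → SimpleGraph V → ℕ → Set
IsCliqueNumber G w = HasClique G w × ¬ HasClique G (suc w)

Colorable : {V : Set} → SimpleGraph V → ℕ → Set
Colorable {V} G c =
  Σ (V → Fin c) λ col → ∀ u v → adj G u v ≡ true → col u ≢ col v

sumFrom2 : (ℕ → ℕ) → ℕ → ℕ
sumFrom2 h zero = 0
sumFrom2 h (suc zero) = 0
sumFrom2 h (suc (suc k)) = sumFrom2 h (suc k) + h (suc (suc k))

-- f p m = f_p(m) for p ≥ 2, m ≥ 1 exactly as in the paper.
-- Conventions outside the paper's domain (never used for nonempty graphs):
-- f p 0 = 0 (only the empty graph has ω = 0), f 0 m = f 1 m = 0.
f : ℕ → ℕ → ℕ
f zero m = 0
f (suc zero) m = 0
f (suc (suc zero)) zero = 0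
f (suc (suc zero)) (suc zero) = 1
f (suc (suc zero)) (suc (suc s)) = suc (suc s) + 1
f (suc (suc (suc q))) zero = 0
f (suc (suc (suc q))) (suc zero) = 1
f (suc (suc (suc q))) (suc (suc zero)) = 2 * suc (suc (suc q)) ∸ 2
f (suc (suc (suc q))) (suc (suc (suc r))) =
  sumFrom2 (f (suc (suc q))) (suc (suc (suc r)))
  + f (suc (suc q)) (suc (suc r)) + 1

{-# OPTIONS --safe #-}
module Submission where

-- Let K be a clique of maximum size m ≥ 3, and order it. A vertex missing two vertices of K is put into the
-- class of the first pair v_i, v_j (i < j, j minimal) that it misses. Such a class avoids (p−1)K₂, because
-- v_i v_j is an edge away from it, and it has clique number at most m − j + 2, because it is joined to the
-- other vertices of K up to v_j. For fixed j ≥ 4 the classes are pairwise anticomplete: an edge x y between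
-- the classes of (i, j) and (i′, j) closes the 4-cycle x v_i′ v_i y, for which a third vertex of K is a hub.
-- So each j costs f_{p−1}(m − j + 2) colours, j = 3 costs this twice, and v_j is coloured along with its
-- class (v_1 with that of (1, 3)). By the same wheel argument the vertices outside K that miss only
-- one vertex of K are independent. With f_1 = 1 this also covers p = 2.
--
-- Triangle-free graphs (m = 2) lose one K₂ at the cost of the two colours of N(u) and N(v), for an edge u v.
-- This gives 2p − 2 once triangle-free 3K₂-free graphs are shown to be 4-colourable. There the vertices far
-- from u and v form a 2K₂-free graph, so they are 2-colourable or a blow-up A₀, …, A₄ of a pentagon together
-- with isolated vertices I. In the second case 4-colourings are attempted, one for each i mod 5; if all fail,
-- there are x_i ∈ N(u) with neighbours l_i ∈ A_{i−1}, r_i ∈ A_{i+1} and z_i ∈ I, where z_i has a neighbour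
-- y_i ∈ N(v). Edges such as x_i l_i, x_{i+1} r_{i+1} are far apart, and forbidding 3K₂ then forces a "centre"
-- c on each pair (z_i, y_i): z_i is adjacent to x_c, x_{c+2}, x_{c+3} and y_i to the other two x's. Two pairs
-- with consecutive centres yield an induced 3K₂, and consecutive centres cannot be avoided.

open import Defs hiding (sym)
open import Data.Bool using (Bool; true; false; T?)
open import Data.Bool.Properties using (T-irrelevant; ¬-not) renaming (_≟_ to _≟ᵇ_)
open import Data.Empty using (⊥; ⊥-elim)
open import Data.Fin using (Fin; zero; suc; toℕ; fromℕ<; inject≤)
open import Data.Fin.Patterns using (0F; 1F; 2F; 3F; 4F)
open import Data.Fin.Properties using (any?; all?; _≟_; toℕ<n; toℕ-injective; fromℕ<-injective; inject≤-injective)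
open import Data.List using (List; []; _∷_; _++_; length; filter; lookup)
open import Data.List.Membership.Propositional using (_∈_; _∉_; find)
open import Data.List.Membership.Propositional.Properties using (∈-filter⁻; ∈-lookup)
open import Data.List.Properties using (length-++; filter-all)
open import Data.List.Relation.Unary.All as All using (All; []; _∷_)
open import Data.List.Relation.Unary.All.Properties using (¬Any⇒All¬; ++⁺)
open import Data.List.Relation.Unary.AllPairs using (AllPairs; []; _∷_)
import Data.List.Relation.Unary.AllPairs.Properties as AllPairs
open import Data.List.Relation.Unary.Any as Any using (Any; here; there)
open import Data.Nat using (ℕ; zero; suc; _+_; _≤_; _<_; z≤n; s≤s; s≤s⁻¹)
open import Data.Nat.Properties hiding (_≟_)
open import Data.Nat.Tactic.RingSolver using (solve-∀)
open import Data.Product using (Σ; ∃; ∃₂; _×_; _,_; proj₁; proj₂)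
open import Data.Sum using (_⊎_; inj₁; inj₂; [_,_]′)
open import Data.Unit using (⊤; tt)
open import Function using (_∘_; id)
open import Relation.Binary.PropositionalEquality using (_≡_; _≢_; refl; sym; trans; cong; subst)
open import Relation.Nullary using (¬_; Dec; yes; no; isYes; ¬?)
open import Relation.Nullary.Decidable using (_×-dec_; _⊎-dec_; map′; decidable-stable)
open import Relation.Nullary.Decidable using (True; toWitness; fromWitness; from-yes)
open import Relation.Unary using (Decidable; _∩_; _∪_; ∁; _⊆_)

-- Triangle-free 3K₂-free graphs

next : Fin 5 → Fin 5
next 0F = 1F
next 1F = 2F
next 2F = 3F
next 3F = 4F
next 4F = 0F

next² next³ next⁴ : Fin 5 → Fin 5
next² i = next (next i)
next³ i = next (next² i)
next⁴ i = next (next³ i)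

next⁵-id : ∀ i → next (next⁴ i) ≡ i
next⁵-id 0F = refl
next⁵-id 1F = refl
next⁵-id 2F = refl
next⁵-id 3F = refl
next⁵-id 4F = refl

next-orbit : ∀ i j → j ≡ i ⊎ j ≡ next i ⊎ j ≡ next² i ⊎ j ≡ next³ i ⊎ j ≡ next⁴ i
next-orbit = from-yes (all? λ i → all? λ j →
  (j ≟ i) ⊎-dec (j ≟ next i) ⊎-dec (j ≟ next² i) ⊎-dec (j ≟ next³ i) ⊎-dec (j ≟ next⁴ i))

-- `search` stands in for finiteness of `W`, so that `W` can later be the subtype of a decidable
-- vertex set. The shape of `no-K₃` lets it serve directly as the independence of a neighbourhood.
module TriangleFree3K₂Free
  {W : Set} (_~_ : W → W → Set)
  (~-sym : ∀ {a b} → a ~ b → b ~ a)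
  (_~?_ : ∀ a b → Dec (a ~ b))
  (search : ∀ {P : W → Set} → Decidable P → Dec (∃ P))
  (no-K₃ : ∀ {a b c} → c ~ a → c ~ b → ¬ (a ~ b))
  where

  infix 4 _≁_
  _≁_ : W → W → Set
  a ≁ b = ¬ (a ~ b)

  ≁-sym : ∀ {a b} → a ≁ b → b ≁ a
  ≁-sym a≁b = a≁b ∘ ~-sym

  Separated : W → W → W → W → Set
  Separated a b c d = a ≁ c × a ≁ d × b ≁ c × b ≁ d

  Indep : (W → Set) → Set
  Indep P = ∀ {a b} → P a → P b → a ≁ b

  Anti : (W → Set) → (W → Set) → Set
  Anti P Q = ∀ {a b} → P a → Q b → a ≁ b

  Indep-∪ : ∀ {P Q} → Indep P → Indep Q → Anti P Q → Indep (P ∪ Q)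
  Indep-∪ p q pq (inj₁ a) (inj₁ b) = p a b
  Indep-∪ p q pq (inj₁ a) (inj₂ b) = pq a b
  Indep-∪ p q pq (inj₂ a) (inj₁ b) = ≁-sym (pq b a)
  Indep-∪ p q pq (inj₂ a) (inj₂ b) = q a b

  Colouring : Set
  Colouring = Σ (W → Fin 4) λ col → ∀ {a b} → a ~ b → ¬ (col a ≡ col b)

  -- The classes may overlap; each vertex takes the one that `cover` picks.
  cover⇒colouring : (P : Fin 4 → W → Set) → (∀ k → Indep (P k)) → (∀ w → ∃ λ k → P k w) → Colouring
  cover⇒colouring P indep cover = (λ w → proj₁ (cover w)) , λ {a} {b} a~b same →
    indep _ (subst (λ k → P k a) same (proj₂ (cover a))) (proj₂ (cover b)) a~b

  module Around
    (no-3K₂ : ∀ {a b c d e f} → a ~ b → c ~ d → e ~ f →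
      Separated a b c d → Separated a b e f → Separated c d e f → ⊥)
    {u v : W} (u~v : u ~ v)
    where

    Far : W → Set
    Far w = u ≁ w × v ≁ w

    far? : Decidable Far
    far? w = ¬? (u ~? w) ×-dec ¬? (v ~? w)

    no-far-2K₂ : ∀ {a b c d} → Far a → Far b → Far c → Far d → a ~ b → c ~ d → ¬ Separated a b c d
    no-far-2K₂ (ua , va) (ub , vb) (uc , vc) (ud , vd) ab cd =
      no-3K₂ u~v ab cd (ua , ub , va , vb) (uc , ud , vc , vd)

    near⊎far : ∀ w → u ~ w ⊎ v ~ w ⊎ Far w
    near⊎far w with u ~? w | v ~? w
    ... | yes uw | _      = inj₁ uw
    ... | no _   | yes vw = inj₂ (inj₁ vw)
    ... | no ¬uw | no ¬vw = inj₂ (inj₂ (¬uw , ¬vw))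

    record Pentagon : Set where
      field
        a     : Fin 5 → W
        far   : ∀ i → Far (a i)
        side  : ∀ i → a i ~ a (next i)
        chord : ∀ i → a i ≁ a (next² i)

    -- Fix a far edge c d; if there is none, three colours do. `Rest` is independent, since an edge
    -- in it would form a far 2K₂ with c d. Hence the far neighbours of c, together with the members
    -- of `Rest` sharing no far neighbour with c, are independent, and likewise for d. These two
    -- classes cover the far vertices unless some w in `Rest` shares a far neighbour s with c and t
    -- with d; then w, s, c, d, t is the pentagon.
    pentagon⊎colouring : Pentagon ⊎ Colouring
    pentagon⊎colouring with (search λ c → search λ d → far? c ×-dec far? d ×-dec (c ~? d))
    ... | no no-edge = inj₂ (cover⇒colouring
      (λ { 0F → u ~_ ; 1F → v ~_ ; _ → Far })
      (λ { 0F → no-K₃ ; 1F → no-K₃ ; 2F → far-indep ; 3F → far-indep })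
      λ w → [ 0F ,_ , [ 1F ,_ , 2F ,_ ]′ ]′ (near⊎far w))
      where
      far-indep : Indep Far
      far-indep fa fb e = no-edge (_ , _ , fa , fb , e)
    ... | yes (c , d , fc , fd , c~d) = go (search λ w → rest? w ×-dec meets? c w ×-dec meets? d w)
      where
      Rest : W → Set
      Rest w = Far w × c ≁ w × d ≁ w
      rest? : Decidable Rest
      rest? w = far? w ×-dec ¬? (c ~? w) ×-dec ¬? (d ~? w)
      Meets : W → W → Set
      Meets c w = ∃ λ s → Far s × c ~ s × w ~ s
      meets? : ∀ c → Decidable (Meets c)
      meets? c w = search λ s → far? s ×-dec (c ~? s) ×-dec (w ~? s)

      side-class : W → W → Set
      side-class c = (λ w → Far w × c ~ w) ∪ (λ w → Rest w × ¬ Meets c w)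

      indep-side : ∀ c → Indep (side-class c)
      indep-side c = Indep-∪ (λ (_ , p) (_ , q) → no-K₃ p q)
        (λ ((fa , ca , da) , _) ((fb , cb , db) , _) e →
          no-far-2K₂ fc fd fa fb c~d e (ca , cb , da , db))
        (λ (fa , ca) (_ , ¬m) e → ¬m (_ , fa , ca , ~-sym e))

      go : Dec (∃ λ w → Rest w × Meets c w × Meets d w) → Pentagon ⊎ Colouring
      go (yes (w , (fw , cw , dw) , (s , fs , cs , ws) , (t , ft , dt , wt))) = inj₁ record
        { a     = λ { 0F → w ; 1F → s ; 2F → c ; 3F → d ; 4F → t }
        ; far   = λ { 0F → fw ; 1F → fs ; 2F → fc ; 3F → fd ; 4F → ft }
        ; side  = λ { 0F → ws ; 1F → ~-sym cs ; 2F → c~d ; 3F → dt ; 4F → ~-sym wt }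
        ; chord = λ { 0F → ≁-sym cw ; 1F → no-K₃ cs c~d ; 2F → no-K₃ (~-sym c~d) dt
                    ; 3F → dw ; 4F → no-K₃ wt ws }
        }
      go (no ¬both) = inj₂ (cover⇒colouring
        (λ { 0F → u ~_ ; 1F → v ~_ ; 2F → side-class c ; 3F → side-class d })
        (λ { 0F → no-K₃ ; 1F → no-K₃ ; 2F → indep-side c ; 3F → indep-side d })
        λ w → [ 0F ,_ , [ 1F ,_ , (λ fw → [ 2F ,_ , 3F ,_ ]′ (far-cover w fw)) ]′ ]′ (near⊎far w))
        where
        far-cover : ∀ w → Far w → side-class c w ⊎ side-class d w
        far-cover w fw with c ~? w | d ~? w | meets? c w | meets? d w
        ... | yes cw | _ | _ | _ = inj₁ (inj₁ (fw , cw))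
        ... | no _ | yes dw | _ | _ = inj₂ (inj₁ (fw , dw))
        ... | no cw | no dw | no mc | _ = inj₁ (inj₂ ((fw , cw , dw) , mc))
        ... | no cw | no dw | yes _ | no md = inj₂ (inj₂ ((fw , cw , dw) , md))
        ... | no cw | no dw | yes mc | yes md = ⊥-elim (¬both (w , (fw , cw , dw) , mc , md))

    -- The far vertices as a blown-up pentagon with isolated vertices

    module Blowup (C : Pentagon) where
      open Pentagon C

      -- Indices are modulo 5 and `next⁴ i` is i - 1, so this is the class blown up from `a i`.
      A : Fin 5 → W → Set
      A i w = Far w × a (next⁴ i) ~ w × a (next i) ~ w

      A? : ∀ i → Decidable (A i)
      A? i w = far? w ×-dec (a (next⁴ i) ~? w) ×-dec (a (next i) ~? w)

      I : W → Set
      I w = Far w × ∀ i → a i ≁ w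

      I? : Decidable I
      I? w = far? w ×-dec all? λ i → ¬? (a i ~? w)

      -- `next (next⁴ i)` does not compute to `i` for a variable `i`, hence these transports.
      shift : ∀ {P : Fin 5 → Set} {i} → P (next (next⁴ i)) → P i
      shift {P} = subst P (next⁵-id _)

      unshift : ∀ {P : Fin 5 → Set} {i} → P i → P (next (next⁴ i))
      unshift {P} = subst P (sym (next⁵-id _))

      -- Otherwise a_{i-1} b and a_{i+2} b′ would be a far 2K₂.
      A-joined : ∀ {i b b′} → A i b → A (next i) b′ → b ~ b′
      A-joined {i} {b} {b′} (fb , b₄ , b₁) (fb′ , b₀′ , b₂′) = decidable-stable (b ~? b′) λ b≁b′ →
        no-far-2K₂ (far _) fb (far _) fb′ b₄ b₂′
          ( ≁-sym (chord _) , no-K₃ (~-sym (side _)) b₀′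
          , ≁-sym (no-K₃ (side _) b₁) , b≁b′)

      A-indep : ∀ {i} → Indep (A i)
      A-indep (_ , _ , p) (_ , _ , q) = no-K₃ p q

      A-apart₂ : ∀ {i} → Anti (A i) (A (next² i))
      A-apart₂ {i} (_ , _ , b₁) (_ , b₁′ , _) = no-K₃ b₁ (shift {λ j → a j ~ _} b₁′)

      -- An edge z b would form a far 2K₂ with the side a_{i+2} a_{i+3} opposite to b.
      I-apart : ∀ {i} → Anti I (A i)
      I-apart (fz , z≁) (fb , b₄ , b₁) z~b = no-far-2K₂ fz fb (far _) (far _) z~b (side _)
        (≁-sym (z≁ _) , ≁-sym (z≁ _) , no-K₃ b₁ (side _) , no-K₃ b₄ (~-sym (side _)))

      I-indep : Indep I
      I-indep (fz , z≁) (fz′ , z′≁) z~z′ = no-far-2K₂ fz fz′ (far 0F) (far 1F) z~z′ (side 0F)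
        (≁-sym (z≁ _) , ≁-sym (z≁ _) , ≁-sym (z′≁ _) , ≁-sym (z′≁ _))

      -- If w sees a_i, the side a_{i+2} a_{i+3} forces it to see a_{i+2} or a_{i+3} too, which puts
      -- it in A_{i+1} or A_{i-1}.
      far-cases : ∀ {w} → Far w → I w ⊎ ∃ λ i → A i w
      far-cases {w} fw with any? (λ i → a i ~? w)
      ... | no ¬nbr = inj₁ (fw , λ i aw → ¬nbr (i , aw))
      ... | yes (i , aᵢ~w) with a (next² i) ~? w | a (next³ i) ~? w
      ... | yes a₂~w | _ = inj₂ (next i , fw , unshift {λ j → a j ~ w} aᵢ~w , a₂~w)
      ... | no _ | yes a₃~w = inj₂ (next⁴ i , fw , unshift {λ j → a j ~ w} a₃~w , unshift {λ j → a j ~ w} aᵢ~w)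
      ... | no a₂≁w | no a₃≁w = ⊥-elim (no-far-2K₂ (far i) fw (far _) (far _) aᵢ~w (side (next² i))
              ( chord i , ≁-sym (shift {λ j → a (next³ i) ≁ a j} (chord (next³ i)))
              , ≁-sym a₂≁w , ≁-sym a₃≁w))

      Meets : (W → Set) → W → Set
      Meets P w = ∃ λ b → P b × w ~ b

      meets? : ∀ {P} → Decidable P → Decidable (Meets P)
      meets? P? w = search λ b → P? b ×-dec (w ~? b)

      I* : W → Set
      I* z = I z × Meets (v ~_) z

      I*? : Decidable I*
      I*? z = I? z ×-dec meets? (v ~?_) z

      not-consecutive : ∀ {i w} → Meets (A i) w → ¬ Meets (A (next i)) w
      not-consecutive (b , Ab , wb) (b′ , Ab′ , wb′) = no-K₃ wb wb′ (A-joined Ab Ab′)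

      Obstruction : Fin 5 → W → Set
      Obstruction i x = u ~ x × Meets (A (next⁴ i)) x × Meets (A (next i)) x × Meets I* x

      -- Start from the classes N(u) ∪ Aᵢ, N(v), Aᵢ₊₁ ∪ Aᵢ₊₃, Aᵢ₊₂ ∪ Aᵢ₊₄. Vertices of I go to N(v) when they
      -- can and to N(u) otherwise; the vertices of N(u) that this or Aᵢ displaces go to the last two classes.
      obstruction⊎colouring : ∀ i → ∃ (Obstruction i) ⊎ Colouring
      obstruction⊎colouring i with (search λ x →
        (u ~? x) ×-dec meets? (A? (next⁴ i)) x ×-dec meets? (A? (next i)) x ×-dec meets? I*? x)
      ... | yes ob = inj₁ ob
      ... | no ¬ob = inj₂ (cover⇒colouring class class-indep cover)
        where
        Displaced : W → Set
        Displaced = Meets I* ∪ Meets (A i)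
        displaced? : Decidable Displaced
        displaced? w = meets? I*? w ⊎-dec meets? (A? i) w

        Pair : Fin 5 → W → Set
        Pair j = A j ∪ A (next² j)
        pair? : ∀ j → Decidable (Pair j)
        pair? j w = A? j w ⊎-dec A? (next² j) w

        paired : Fin 5 → W → Set
        paired j = (λ w → u ~ w × ¬ Meets (Pair j) w) ∪ Pair j

        paired-indep : ∀ j → Indep (paired j)
        paired-indep j = Indep-∪ (λ (p , _) (q , _) → no-K₃ p q)
          (Indep-∪ A-indep A-indep A-apart₂) (λ (_ , ¬m) b e → ¬m (_ , b , e))

        class : Fin 4 → W → Set
        class 0F = (λ w → u ~ w × ¬ Displaced w) ∪ I* ∪ A i
        class 1F = (v ~_) ∪ (λ z → I z × ¬ Meets (v ~_) z)
        class 2F = paired (next i)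
        class 3F = paired (next² i)

        class-indep : ∀ k → Indep (class k)
        class-indep 0F = Indep-∪ (λ (p , _) (q , _) → no-K₃ p q)
          (Indep-∪ (λ (p , _) (q , _) → I-indep p q) A-indep (λ (p , _) → I-apart p))
          (λ (_ , ¬d) → λ { (inj₁ b) e → ¬d (inj₁ (_ , b , e)) ; (inj₂ b) e → ¬d (inj₂ (_ , b , e)) })
        class-indep 1F = Indep-∪ no-K₃ (λ (p , _) (q , _) → I-indep p q)
          (λ p (_ , ¬m) e → ¬m (_ , p , ~-sym e))
        class-indep 2F = paired-indep (next i)
        class-indep 3F = paired-indep (next² i)

        cover-A : ∀ {j w} → A j w → ∃ λ k → class k w
        cover-A {j} Aw with next-orbit i j
        ... | inj₁ refl = 0F , inj₂ (inj₂ Aw)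
        ... | inj₂ (inj₁ refl) = 2F , inj₂ (inj₁ Aw)
        ... | inj₂ (inj₂ (inj₁ refl)) = 3F , inj₂ (inj₁ Aw)
        ... | inj₂ (inj₂ (inj₂ (inj₁ refl))) = 2F , inj₂ (inj₂ Aw)
        ... | inj₂ (inj₂ (inj₂ (inj₂ refl))) = 3F , inj₂ (inj₂ Aw)

        -- The two pairs are A_{i+1}, A_{i+3} and A_{i+2}, A_{i+4}. Only the choice A_{i+1}, A_{i+4}
        -- is not consecutive. There a neighbour in `I*` gives the obstruction, and one in A_i is
        -- consecutive to A_{i+1}.
        stuck : ∀ {w} → u ~ w → Displaced w → Meets (Pair (next i)) w → ¬ Meets (Pair (next² i)) w
        stuck uw d (b , inj₁ p , e) (b′ , inj₁ q , e′) = not-consecutive (b , p , e) (b′ , q , e′)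
        stuck uw d (b , inj₂ p , e) (b′ , inj₁ q , e′) = not-consecutive (b′ , q , e′) (b , p , e)
        stuck uw d (b , inj₂ p , e) (b′ , inj₂ q , e′) = not-consecutive (b , p , e) (b′ , q , e′)
        stuck uw (inj₁ m) (b , inj₁ p , e) (b′ , inj₂ q , e′) =
          ¬ob (_ , uw , (b′ , q , e′) , (b , p , e) , m)
        stuck uw (inj₂ m) (b , inj₁ p , e) (b′ , inj₂ q , e′) = not-consecutive m (b , p , e)

        cover : ∀ w → ∃ λ k → class k w
        cover w with near⊎far w
        ... | inj₂ (inj₁ vw) = 1F , inj₁ vw
        ... | inj₂ (inj₂ fw) = [ cover-I , cover-A ∘ proj₂ ]′ (far-cases fw)
          where
          cover-I : I w → ∃ λ k → class k w
          cover-I Iw with meets? (v ~?_) w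
          ... | yes m = 0F , inj₂ (inj₁ (Iw , m))
          ... | no ¬m = 1F , inj₂ (Iw , ¬m)
        ... | inj₁ uw with displaced? w | meets? (pair? (next i)) w | meets? (pair? (next² i)) w
        ... | no ¬d | _ | _ = 0F , inj₁ (uw , ¬d)
        ... | yes _ | no ¬m | _ = 2F , inj₁ (uw , ¬m)
        ... | yes _ | yes _ | no ¬m = 3F , inj₁ (uw , ¬m)
        ... | yes d | yes m | yes m′ = ⊥-elim (stuck uw d m m′)

      -- The configuration left when all five colourings fail

      module Obstructed (ob : ∀ i → ∃ (Obstruction i)) where

        x l r z y : Fin 5 → W
        x i = let x , _ = ob i in x
        l i = let _ , _ , (l , _) , _ = ob i in l
        r i = let _ , _ , _ , (r , _) , _ = ob i in r
        z i = let _ , _ , _ , _ , z , _ = ob i in z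
        y i = let _ , _ , _ , _ , _ , (_ , y , _) , _ = ob i in y

        u~x : ∀ i → u ~ x i
        u~x i = let _ , p , _ = ob i in p
        l∈A : ∀ i → A (next⁴ i) (l i)
        l∈A i = let _ , _ , (_ , p , _) , _ = ob i in p
        x~l : ∀ i → x i ~ l i
        x~l i = let _ , _ , (_ , _ , p) , _ = ob i in p
        r∈A : ∀ i → A (next i) (r i)
        r∈A i = let _ , _ , _ , (_ , p , _) , _ = ob i in p
        x~r : ∀ i → x i ~ r i
        x~r i = let _ , _ , _ , (_ , _ , p) , _ = ob i in p
        z∈I : ∀ i → I (z i)
        z∈I i = let _ , _ , _ , _ , _ , (p , _) , _ = ob i in p
        x~z : ∀ i → x i ~ z i
        x~z i = let _ , _ , _ , _ , _ , _ , p = ob i in p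
        v~y : ∀ i → v ~ y i
        v~y i = let _ , _ , _ , _ , _ , (_ , _ , p , _) , _ = ob i in p
        z~y : ∀ i → z i ~ y i
        z~y i = let _ , _ , _ , _ , _ , (_ , _ , _ , p) , _ = ob i in p

        v≁x : ∀ i → v ≁ x i
        v≁x i = no-K₃ u~v (u~x i)
        v≁A : ∀ {i b} → A i b → v ≁ b
        v≁A ((_ , p) , _) = p
        v≁I : ∀ {z} → I z → v ≁ z
        v≁I ((_ , p) , _) = p
        x≁x : ∀ i j → x i ≁ x j
        x≁x i j = no-K₃ (u~x i) (u~x j)

        -- Every class other than A_{i-1} and A_{i+1} is joined to `l i` or `r i`, so x_i misses it
        -- by triangle-freeness. `x≁A₀` and `x≁A₅` concern the same class, with its index in two
        -- forms.
        x≁A₀ : ∀ i {b} → A i b → x i ≁ b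
        x≁A₀ i p = no-K₃ (~-sym (x~r i)) (~-sym (A-joined p (r∈A i)))
        x≁A₂ : ∀ i {b} → A (next² i) b → x i ≁ b
        x≁A₂ i p = no-K₃ (~-sym (x~r i)) (A-joined (r∈A i) p)
        x≁A₃ : ∀ i {b} → A (next³ i) b → x i ≁ b
        x≁A₃ i p = no-K₃ (~-sym (x~l i)) (~-sym (A-joined p (l∈A i)))
        x≁A₅ : ∀ i {b} → A (next (next⁴ i)) b → x i ≁ b
        x≁A₅ i p = no-K₃ (~-sym (x~l i)) (A-joined (l∈A i) p)

        -- `l i` and `r (next i)` lie in A_{i-1} and A_{i+2}, which are anticomplete, and neither x
        -- sees the other's partner. So x_i l_i and x_{i+1} r_{i+1} are an induced 2K₂.
        no-third : ∀ i {p q} → p ~ q → Separated p q (x i) (l i) →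
          ¬ Separated p q (x (next i)) (r (next i))
        no-third i pq s t = no-3K₂ pq (x~l i) (x~r (next i)) s t
          ( x≁x _ _ , x≁A₂ i (r∈A _) , ≁-sym (x≁A₃ (next i) (l∈A i))
          , ≁-sym (A-apart₂ (r∈A (next i)) (l∈A i)))

        touch : ∀ {i b b′ w} → A i b → A (next i) b′ → w ~ b → w ≁ b′
        touch p q wb wb′ = no-K₃ wb wb′ (A-joined p q)

        nbr-of-v : ∀ i {w} → v ~ w → w ≁ x i → w ≁ x (next i) → w ~ l i ⊎ w ~ r (next i)
        nbr-of-v i {w} v~w w≁x w≁x′ with w ~? l i | w ~? r (next i)
        ... | yes p | _ = inj₁ p
        ... | no _ | yes q = inj₂ q
        ... | no w≁l | no w≁r = ⊥-elim (no-third i v~w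
                (v≁x i , v≁A (l∈A i) , w≁x , w≁l) (v≁x _ , v≁A (r∈A _) , w≁x′ , w≁r))

        -- Apply `no-third` to the edge w x_i against x_{i+1} l_{i+1} and x_{i+2} r_{i+2};
        -- `backward` is the mirror image.
        forward : ∀ i {w} → I w → w ~ x i → w ~ x (next i) ⊎ w ~ x (next² i)
        forward i {w} Iw w~x with w ~? x (next i) | w ~? x (next² i)
        ... | yes p | _ = inj₁ p
        ... | no _ | yes q = inj₂ q
        ... | no w≁x₁ | no w≁x₂ = ⊥-elim (no-third (next i) w~x
                (w≁x₁ , I-apart Iw (l∈A _) , x≁x _ _ , x≁A₅ i (l∈A _))
                (w≁x₂ , I-apart Iw (r∈A _) , x≁x _ _ , x≁A₃ i (r∈A _)))

        backward : ∀ i {w} → I w → w ~ x (next² i) → w ~ x i ⊎ w ~ x (next i)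
        backward i {w} Iw w~x with w ~? x i | w ~? x (next i)
        ... | yes p | _ = inj₁ p
        ... | no _ | yes q = inj₂ q
        ... | no w≁x₀ | no w≁x₁ = ⊥-elim (no-third i w~x
                (w≁x₀ , I-apart Iw (l∈A _) , x≁x _ _ , x≁A₂ (next² i) (l∈A _))
                (w≁x₁ , I-apart Iw (r∈A _) , x≁x _ _ , x≁A₀ (next² i) (r∈A _)))

        record Centred (c : Fin 5) : Set where
          field
            {ζ η} : W
            ζ∈I  : I ζ
            v~η  : v ~ η
            ζ~η  : ζ ~ η
            ζ~x₀ : ζ ~ x c
            ζ~x₂ : ζ ~ x (next² c)
            ζ~x₃ : ζ ~ x (next³ c)
            η~x₁ : η ~ x (next c)
            η~x₄ : η ~ x (next⁴ c)

        -- `η` misses x_c, x_{c+2} and x_{c+3}, which see `ζ`. If it also missed x_{c+1} or x_{c+4},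
        -- `nbr-of-v` at three consecutive indices would give it neighbours among the l's and r's,
        -- and every choice puts two of them in consecutive classes.
        centred : ∀ {c ζ η} → I ζ → v ~ η → ζ ~ η →
          ζ ~ x c → ζ ~ x (next² c) → ζ ~ x (next³ c) → Centred c
        centred {c} {ζ} {η} ζ∈I v~η ζ~η ζ~x₀ ζ~x₂ ζ~x₃ = record
          { ζ∈I = ζ∈I ; v~η = v~η ; ζ~η = ζ~η ; ζ~x₀ = ζ~x₀ ; ζ~x₂ = ζ~x₂ ; ζ~x₃ = ζ~x₃
          ; η~x₁ = decidable-stable (η ~? x (next c)) λ η≁x₁ → one
              (nbr-of-v c v~η η≁x₀ η≁x₁) (nbr-of-v (next c) v~η η≁x₁ η≁x₂)
              (nbr-of-v (next² c) v~η η≁x₂ η≁x₃)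
          ; η~x₄ = decidable-stable (η ~? x (next⁴ c)) λ η≁x₄ → four
              (nbr-of-v (next² c) v~η η≁x₂ η≁x₃) (nbr-of-v (next³ c) v~η η≁x₃ η≁x₄)
              (nbr-of-v (next⁴ c) v~η η≁x₄ (unshift {λ j → η ≁ x j} η≁x₀))
          }
          where
          η≁x₀ = no-K₃ ζ~η ζ~x₀
          η≁x₂ = no-K₃ ζ~η ζ~x₂
          η≁x₃ = no-K₃ ζ~η ζ~x₃
          one : η ~ l c ⊎ η ~ r (next c) → η ~ l (next c) ⊎ η ~ r (next² c) →
            η ~ l (next² c) ⊎ η ~ r (next³ c) → ⊥
          one (inj₁ p) (inj₁ q) _ = touch (l∈A c) (l∈A _) p q
          one (inj₁ p) (inj₂ q) _ = touch (r∈A _) (l∈A c) q p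
          one (inj₂ p) (inj₂ q) _ = touch (r∈A _) (r∈A _) p q
          one (inj₂ p) (inj₁ q) (inj₁ t) = touch (l∈A _) (l∈A _) q t
          one (inj₂ p) (inj₁ q) (inj₂ t) = touch (r∈A _) (l∈A _) t q
          four : η ~ l (next² c) ⊎ η ~ r (next³ c) → η ~ l (next³ c) ⊎ η ~ r (next⁴ c) →
            η ~ l (next⁴ c) ⊎ η ~ r (next (next⁴ c)) → ⊥
          four (inj₁ p) (inj₁ q) _ = touch (l∈A _) (l∈A _) p q
          four (inj₁ p) (inj₂ q) _ = touch (r∈A _) (l∈A _) q p
          four (inj₂ p) (inj₂ q) _ = touch (r∈A _) (r∈A _) p q
          four (inj₂ p) (inj₁ q) (inj₁ t) = touch (l∈A _) (l∈A _) q t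
          four (inj₂ p) (inj₁ q) (inj₂ t) = touch (r∈A _) (l∈A _) t q

        -- Besides x_i, z_i sees x_{i+1} or x_{i+2}, and x_{i+3} or x_{i+4}. Three combinations fix
        -- a centre; for x_{i+1} with x_{i+4}, `forward` from i + 1 leads back to one of them.
        centre : ∀ i → Centred i ⊎ Centred (next² i) ⊎ Centred (next³ i)
        centre i = go (forward i Iz z~x₀) (backward (next³ i) Iz (un z~x₀))
          where
          Iz = z∈I i
          z~x₀ = ~-sym (x~z i)
          un : ∀ {j} → z i ~ x j → z i ~ x (next (next⁴ j))
          un = unshift {λ j → z i ~ x j}
          at₂ : z i ~ x (next² i) → z i ~ x (next⁴ i) → Centred (next² i)
          at₂ p q = centred Iz (v~y i) (z~y i) p q (un z~x₀)
          at₃ : z i ~ x (next i) → z i ~ x (next³ i) → Centred (next³ i)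
          at₃ p q = centred Iz (v~y i) (z~y i) q (un z~x₀) (un p)
          go : z i ~ x (next i) ⊎ z i ~ x (next² i) → z i ~ x (next³ i) ⊎ z i ~ x (next⁴ i) →
            Centred i ⊎ Centred (next² i) ⊎ Centred (next³ i)
          go (inj₁ p) (inj₁ q) = inj₂ (inj₂ (at₃ p q))
          go (inj₂ p) (inj₁ q) = inj₁ (centred Iz (v~y i) (z~y i) z~x₀ p q)
          go (inj₂ p) (inj₂ q) = inj₂ (inj₁ (at₂ p q))
          go (inj₁ p) (inj₂ q) with forward (next i) Iz p
          ... | inj₁ p₂ = inj₂ (inj₁ (at₂ p₂ q))
          ... | inj₂ p₃ = inj₂ (inj₂ (at₃ p p₃))

        -- The induced 3K₂ is η_P x_{c+4}, η_Q x_{c+2}, x_{c+3} l_{c+3}. Here η_P sees r_{c+2} and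
        -- η_Q sees l_{c+4}, both in A_{c+3}, so both miss l_{c+3}, which lies in A_{c+2}.
        no-adjacent-centres : ∀ {c} → Centred c → ¬ Centred (next c)
        no-adjacent-centres {c} P Q = no-3K₂ P.η~x₄ Q.η~x₁ (x~l (next³ c))
            (no-K₃ P.v~η Q.v~η , P.η≁x₂ , ≁-sym Q.η≁x₃ , x≁x _ _)
            ( P.η≁x₃ , (λ e → touch (shift {λ j → A j (l (next³ c))} (l∈A (next³ c))) (r∈A (next² c)) e P.η~r)
            , x≁x _ _ , x≁A₃ _ (l∈A _))
            (Q.η≁x₂ , (λ e → touch (l∈A (next³ c)) (l∈A (next⁴ c)) e Q.η~l) , x≁x _ _ , x≁A₅ _ (l∈A _))
          where
          module P where
            open Centred P public
            η≁x₂ = no-K₃ ζ~η ζ~x₂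
            η≁x₃ = no-K₃ ζ~η ζ~x₃
            η≁ζ′ : η ≁ Centred.ζ Q
            η≁ζ′ = no-K₃ (~-sym η~x₁) (~-sym (Centred.ζ~x₀ Q))
            -- Otherwise v η_P, x_{c+3} ζ_Q and x_{c+2} r_{c+2} would be an induced 3K₂; η_P misses
            -- ζ_Q because x_{c+1} sees both. `Q.η~l` is the mirror image.
            η~r : η ~ r (next² c)
            η~r = decidable-stable (_ ~? _) λ η≁r →
              no-3K₂ v~η (~-sym (Centred.ζ~x₂ Q)) (x~r (next² c))
                (v≁x _ , v≁I (Centred.ζ∈I Q) , η≁x₃ , η≁ζ′)
                (v≁x _ , v≁A (r∈A _) , η≁x₂ , η≁r)
                ( x≁x _ _ , x≁A₀ _ (r∈A _)
                , no-K₃ (~-sym (Centred.ζ~η Q)) (Centred.η~x₁ Q) , I-apart (Centred.ζ∈I Q) (r∈A _))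
          module Q where
            open Centred Q public
            η≁x₂ = no-K₃ ζ~η ζ~x₂
            η≁x₃ = no-K₃ ζ~η ζ~x₃
            η≁ζ′ : η ≁ P.ζ
            η≁ζ′ = no-K₃ (~-sym η~x₁) (~-sym P.ζ~x₂)
            η~l : η ~ l (next⁴ c)
            η~l = decidable-stable (_ ~? _) λ η≁l →
              no-3K₂ v~η (~-sym P.ζ~x₃) (x~l (next⁴ c))
                (v≁x _ , v≁I P.ζ∈I , η≁x₂ , η≁ζ′)
                (v≁x _ , v≁A (l∈A _) , η≁x₃ , η≁l)
                (x≁x _ _ , x≁A₅ _ (l∈A _) , no-K₃ (~-sym P.ζ~η) P.η~x₄ , I-apart P.ζ∈I (l∈A _))

        -- Given a centre c, `centre (next c)` can only yield c + 3. Then `centre (next⁴ c)` offers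
        -- c + 4, c + 1 and c + 2, each consecutive to c or to c + 3.
        impossible : ⊥
        impossible = [ from , [ from , from ]′ ]′ (centre 0F)
          where
          pull : ∀ {j} → Centred (next (next⁴ j)) → Centred j
          pull = shift {Centred}
          push : ∀ {j} → Centred j → Centred (next (next⁴ j))
          push = unshift {Centred}
          from : ∀ {c} → Centred c → ⊥
          from {c} C with centre (next c)
          ... | inj₁ D = no-adjacent-centres C D
          ... | inj₂ (inj₂ D) = no-adjacent-centres D (push C)
          ... | inj₂ (inj₁ D) with centre (next⁴ c)
          ... | inj₁ E = no-adjacent-centres E (push C)
          ... | inj₂ (inj₁ E) = no-adjacent-centres C (pull E)
          ... | inj₂ (inj₂ E) = no-adjacent-centres (pull E) D

      colouring : Colouring
      colouring with obstruction⊎colouring 0F | obstruction⊎colouring 1F | obstruction⊎colouring 2F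
                   | obstruction⊎colouring 3F | obstruction⊎colouring 4F
      ... | inj₂ c | _ | _ | _ | _ = c
      ... | _ | inj₂ c | _ | _ | _ = c
      ... | _ | _ | inj₂ c | _ | _ = c
      ... | _ | _ | _ | inj₂ c | _ = c
      ... | _ | _ | _ | _ | inj₂ c = c
      ... | inj₁ o₀ | inj₁ o₁ | inj₁ o₂ | inj₁ o₃ | inj₁ o₄ =
        ⊥-elim (Obstructed.impossible λ { 0F → o₀ ; 1F → o₁ ; 2F → o₂ ; 3F → o₃ ; 4F → o₄ })

  four-colouring :
    (∀ {a b c d e f} → a ~ b → c ~ d → e ~ f →
      Separated a b c d → Separated a b e f → Separated c d e f → ⊥) → Colouring
  four-colouring no-3K₂ with (search λ u → search λ v → u ~? v)
  ... | no no-edge = (λ _ → 0F) , λ a~b _ → no-edge (_ , _ , a~b)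
  ... | yes (u , v , u~v) = [ Blowup.colouring , id ]′ pentagon⊎colouring
    where open Around no-3K₂ u~v

-- The bounding function

sumFrom2-const : ∀ k → sumFrom2 (λ _ → 1) (suc k) ≡ k
sumFrom2-const zero = refl
sumFrom2-const (suc k) = trans (+-comm _ 1) (cong suc (sumFrom2-const k))

f-pos : ∀ q t → 1 ≤ f (2 + q) (2 + t)
f-pos zero t = s≤s z≤n
f-pos (suc q) zero = s≤s z≤n
f-pos (suc q) (suc t) = m≤n+m 1 _

f-two-step : ∀ q → f (3 + q) 2 ≤ f (2 + q) 2 + 2
f-two-step zero = n≤1+n 4
f-two-step (suc q) = ≤-reflexive (arith q)
  where
  arith : ∀ q → 2 + q + (4 + q + 0) ≡ 1 + q + (3 + q + 0) + 2
  arith = solve-∀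

-- This lets a set of smaller clique number use the larger bound. The value at 2 is not given by the
-- recursion, so the step from 2 to 3 goes through `f-two-step`.
f-mono : ∀ q r → f (2 + q) (2 + r) ≤ f (2 + q) (3 + r)
f-mono zero r = n≤1+n _
f-mono (suc q) zero = ≤-trans (f-two-step q) (≤-trans (+-monoʳ-≤ h₂ (s≤s (f-pos q 0)))
    (≤-trans (m≤n+m _ h₃) (≤-reflexive (arith h₂ h₃))))
  where
  h₂ h₃ : ℕ
  h₂ = f (2 + q) 2
  h₃ = f (2 + q) 3
  arith : ∀ x y → y + (x + (1 + x)) ≡ x + y + x + 1
  arith = solve-∀
f-mono (suc q) (suc r) = +-monoˡ-≤ 1 (+-mono-≤ (m≤m+n _ (f (2 + q) (4 + r))) (f-mono q r))

-- Colouring induced subgraphs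

module Colouring-bounds {n : ℕ} (G : FinGraph n) where

  V : Set
  V = Fin n

  infix 4 _~_ _≁_
  _~_ _≁_ : V → V → Set
  a ~ b = adj G a b ≡ true
  a ≁ b = ¬ (a ~ b)

  _~?_ : ∀ a b → Dec (a ~ b)
  a ~? b = adj G a b ≟ᵇ true

  ~-sym : ∀ {a b} → a ~ b → b ~ a
  ~-sym {a} {b} = trans (SimpleGraph.sym G b a)

  ~⇒≢ : ∀ {a b} → a ~ b → a ≢ b
  ~⇒≢ {a} a~a refl with () ← trans (sym a~a) (irrefl G a)

  ≁-sym : ∀ {a b} → a ≁ b → b ≁ a
  ≁-sym a≁b = a≁b ∘ ~-sym

  -- The colouring is total on `V` with arbitrary values outside `S`, so passing to a subset keeps
  -- the same function.
  record Col (S : V → Set) (c : ℕ) : Set where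
    field
      col     : V → ℕ
      bounded : ∀ {x} → S x → col x < c
      proper  : ∀ {x y} → S x → S y → x ~ y → col x ≢ col y
  open Col

  Col-mono : ∀ {S T c d} → S ⊆ T → c ≤ d → Col T c → Col S d
  Col-mono S⊆T c≤d C = record
    { col = col C
    ; bounded = λ s → ≤-trans (bounded C (S⊆T s)) c≤d
    ; proper = λ s t → proper C (S⊆T s) (S⊆T t) }

  Col-indep : ∀ {S} → (∀ {x y} → S x → S y → x ≁ y) → Col S 1
  Col-indep indep = record
    { col = λ _ → 0 ; bounded = λ _ → s≤s z≤n ; proper = λ s t x~y _ → indep s t x~y }

  Col-split : ∀ {S P c d} → Decidable P → Col (S ∩ P) c → Col (S ∩ ∁ P) d → Col S (c + d)
  Col-split {S} {P} {c} {d} P? C D = record { col = k ; bounded = b ; proper = p }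
    where
    k : V → ℕ
    k x with P? x
    ... | yes _ = col C x
    ... | no _ = c + col D x
    b : ∀ {x} → S x → k x < c + d
    b {x} s with P? x
    ... | yes px = ≤-trans (bounded C (s , px)) (m≤m+n c d)
    ... | no ¬px = +-monoʳ-< c (bounded D (s , ¬px))
    p : ∀ {x y} → S x → S y → x ~ y → k x ≢ k y
    p {x} {y} s t e with P? x | P? y
    ... | yes px | yes py = proper C (s , px) (t , py) e
    ... | no ¬px | no ¬py = proper D (s , ¬px) (t , ¬py) e ∘ +-cancelˡ-≡ c _ _
    ... | yes px | no _ = <⇒≢ (≤-trans (bounded C (s , px)) (m≤m+n c _))
    ... | no _ | yes py = <⇒≢ (≤-trans (bounded C (t , py)) (m≤m+n c _)) ∘ sym

  -- Used to colour a clique vertex along with a class it is anticomplete to; `1≤c` makes colour 0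
  -- available for it.
  Col-isolated : ∀ {S P c} v → 1 ≤ c → (∀ {x} → S x → x ≡ v ⊎ P x) → (∀ {x} → P x → v ≁ x) →
    Col P c → Col S c
  Col-isolated {S} {P} {c} v 1≤c split anti C = record { col = k ; bounded = b ; proper = p }
    where
    k : V → ℕ
    k x with x ≟ v
    ... | yes _ = 0
    ... | no _ = col C x
    in-P : ∀ {x} → S x → x ≢ v → P x
    in-P s x≢v = [ ⊥-elim ∘ x≢v , id ]′ (split s)
    b : ∀ {x} → S x → k x < c
    b {x} s with x ≟ v
    ... | yes _ = 1≤c
    ... | no x≢v = bounded C (in-P s x≢v)
    p : ∀ {x y} → S x → S y → x ~ y → k x ≢ k y
    p {x} {y} s t e with x ≟ v | y ≟ v
    ... | yes refl | yes refl = λ _ → ~⇒≢ e refl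
    ... | yes refl | no y≢v = λ _ → anti (in-P t y≢v) e
    ... | no x≢v | yes refl = λ _ → anti (in-P s x≢v) (~-sym e)
    ... | no x≢v | no y≢v = proper C (in-P s x≢v) (in-P t y≢v) e

  -- The fibres of `g` are pairwise anticomplete, so they share one palette.
  Col-glue : ∀ {S} {D : V → Set} {c} (g : V → V) → Decidable D → (∀ {x} → S x → D (g x)) →
    (∀ {x y} → S x → S y → x ~ y → g x ≡ g y) →
    (∀ v → D v → Col (λ x → S x × g x ≡ v) c) → Col S c
  Col-glue {S} {D} {c} g D? S⇒D same C = record
    { col = λ x → κ (g x) x
    ; bounded = λ s → κ-bounded s (S⇒D s)
    ; proper = λ {x} {y} s t e → subst (λ v → κ (g x) x ≢ κ v y) (same s t e)
        (κ-proper (S⇒D s) (s , refl) (t , sym (same s t e)) e) }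
    where
    κ : V → V → ℕ
    κ v x with D? v
    ... | yes d = col (C v d) x
    ... | no _ = 0
    κ-bounded : ∀ {x} → S x → D (g x) → κ (g x) x < c
    κ-bounded {x} s d with D? (g x)
    ... | yes d′ = bounded (C (g x) d′) (s , refl)
    ... | no ¬d = ⊥-elim (¬d d)
    κ-proper : ∀ {v x y} → D v → S x × g x ≡ v → S y × g y ≡ v → x ~ y → κ v x ≢ κ v y
    κ-proper {v} d s t e with D? v
    ... | yes d′ = proper (C v d′) s t e
    ... | no ¬d = ⊥-elim (¬d d)

  -- Cliques and induced matchings in a vertex set

  Clique : ℕ → (V → Set) → Set
  Clique k S = ∃ λ xs → k ≤ length xs × All S xs × AllPairs _~_ xs

  clique? : ∀ k {S} → Decidable S → Dec (Clique k S)
  clique? zero S? = yes ([] , z≤n , [] , [])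
  clique? (suc k) {S} S? = map′ to from
    (any? λ v → S? v ×-dec clique? k {λ x → S x × v ~ x} (λ x → S? x ×-dec (v ~? x)))
    where
    to : (∃ λ v → S v × Clique k (λ x → S x × v ~ x)) → Clique (suc k) S
    to (v , sv , xs , k≤ , sxs , cxs) = v ∷ xs , s≤s k≤ , sv ∷ All.map proj₁ sxs , All.map proj₂ sxs ∷ cxs
    from : Clique (suc k) S → ∃ λ v → S v × Clique k (λ x → S x × v ~ x)
    from (v ∷ xs , s≤s k≤ , sv ∷ sxs , vxs ∷ cxs) = v , sv , xs , k≤ , All.zip (sxs , vxs) , cxs

  clique-edge : ∀ {xs a b} → AllPairs _~_ xs → a ∈ xs → b ∈ xs → a ≢ b → a ~ b
  clique-edge (p ∷ _) (here refl) (here refl) a≢b = ⊥-elim (a≢b refl)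
  clique-edge (p ∷ _) (here refl) (there b∈) _ = All.lookup p b∈
  clique-edge (p ∷ _) (there a∈) (here refl) _ = ~-sym (All.lookup p a∈)
  clique-edge (_ ∷ c) (there a∈) (there b∈) a≢b = clique-edge c a∈ b∈ a≢b

  infixl 5 _∖_
  _∖_ : List V → V → List V
  xs ∖ v = filter (λ w → ¬? (w ≟ v)) xs

  -- A clique has no repetitions, so the filter drops at most one entry.
  ∖-length : ∀ {xs} v → AllPairs _~_ xs → length xs ≤ suc (length (xs ∖ v))
  ∖-length v [] = z≤n
  ∖-length {x ∷ xs} v (p ∷ c) with x ≟ v
  ... | no _ = s≤s (∖-length v c)
  ... | yes refl rewrite filter-all (λ w → ¬? (w ≟ x)) (All.map (λ e → ~⇒≢ e ∘ sym) p) = ≤-refl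

  ∈-∖⁻ : ∀ {xs v w} → w ∈ xs ∖ v → w ∈ xs × w ≢ v
  ∈-∖⁻ {v = v} = ∈-filter⁻ (λ w → ¬? (w ≟ v))

  third-vertex : ∀ {xs} → AllPairs _~_ xs → 3 ≤ length xs → ∀ v v′ → ∃ λ w → w ∈ xs × w ≢ v × w ≢ v′
  third-vertex {xs} c 3≤ v v′ = go (xs ∖ v ∖ v′) refl
    (s≤s⁻¹ (≤-trans (s≤s⁻¹ (≤-trans 3≤ (∖-length v c))) (∖-length v′ (AllPairs.filter⁺ _ c))))
    where
    go : ∀ ys → ys ≡ (xs ∖ v) ∖ v′ → 1 ≤ length ys → ∃ λ w → w ∈ xs × w ≢ v × w ≢ v′
    go (w ∷ _) eq _ =
      let w∈ , w≢v′ = ∈-∖⁻ {xs ∖ v} (subst (w ∈_) eq (here refl))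
          w∈xs , w≢v = ∈-∖⁻ {xs} w∈
      in w , w∈xs , w≢v , w≢v′

  -- The recursion matches the use: what lies off an edge has one K₂ less. Since `a ~ b`, the next
  -- level excludes `a` and `b` themselves.
  InducedMatching : ℕ → (V → Set) → Set
  InducedMatching zero S = ⊤
  InducedMatching (suc q) S = ∃₂ λ a b → S a × S b × a ~ b × InducedMatching q (λ x → S x × a ≁ x × b ≁ x)

  matching-mono : ∀ q {S T} → S ⊆ T → InducedMatching q S → InducedMatching q T
  matching-mono zero S⊆T _ = tt
  matching-mono (suc q) S⊆T (a , b , sa , sb , e , m) =
    a , b , S⊆T sa , S⊆T sb , e , matching-mono q (λ (s , t) → S⊆T s , t) m

  WheelFree : Set
  WheelFree = ∀ {h a b c d} → h ~ a → h ~ b → h ~ c → h ~ d → a ~ b → b ~ c → c ~ d → d ~ a →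
    a ≁ c → b ≁ d → a ≢ c → b ≢ d → ⊥

  -- One step of the recursion: colouring around a maximum clique

  module Step
    (no-wheel : WheelFree)
    {S : V → Set} (S? : Decidable S) {q m : ℕ}
    (no-matching : ¬ InducedMatching (suc q) S) (no-clique : ¬ Clique (suc m) S)
    -- `h` plays the role of f_{p-1}; keeping it abstract lets the constant 1 serve as f_1.
    (h : ℕ → ℕ) (h-pos : ∀ t → 1 ≤ h (2 + t))
    (h-bound : ∀ t {T} → Decidable T → ¬ InducedMatching q T → ¬ Clique (3 + t) T → Col T (h (2 + t)))
    where

    no-matching-off-edge : ∀ {T a b} → S a → S b → a ~ b → T ⊆ (λ x → S x × a ≁ x × b ≁ x) →
      ¬ InducedMatching q T
    no-matching-off-edge sa sb e T⊆ m = no-matching (_ , _ , sa , sb , e , matching-mono q T⊆ m)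

    MissesAtMostOne : List V → V → Set
    MissesAtMostOne K x = S x × x ∉ K × (∀ {v w} → v ∈ K → w ∈ K → x ≁ v → x ≁ w → v ≡ w)

    hits-others : ∀ {K x v w} → MissesAtMostOne K x → v ∈ K → w ∈ K → x ≁ v → w ≢ v → x ~ w
    hits-others {x = x} {w = w} (_ , _ , one) v∈ w∈ x≁v w≢v =
      decidable-stable (x ~? w) λ x≁w → w≢v (one w∈ v∈ x≁w x≁v)

    -- Otherwise x, w, v, y is a 4-cycle, and a third vertex of K is a hub for it.
    same-miss : ∀ {K x y v w} → AllPairs _~_ K → 3 ≤ length K →
      MissesAtMostOne K x → MissesAtMostOne K y → x ~ y →
      v ∈ K → w ∈ K → x ≁ v → y ≁ w → v ≡ w
    same-miss {K} {x} {y} {v} {w} cK 3≤ mx my x~y v∈ w∈ x≁v y≁w = decidable-stable (v ≟ w) λ v≢w →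
      let k , k∈ , k≢v , k≢w = third-vertex cK 3≤ v w in
      no-wheel {k} {x} {w} {v} {y}
        (~-sym (hits-others mx v∈ k∈ x≁v k≢v)) (clique-edge cK k∈ w∈ k≢w)
        (clique-edge cK k∈ v∈ k≢v) (~-sym (hits-others my w∈ k∈ y≁w k≢w))
        (hits-others mx v∈ w∈ x≁v (v≢w ∘ sym)) (clique-edge cK w∈ v∈ (v≢w ∘ sym))
        (~-sym (hits-others my w∈ v∈ y≁w v≢w)) (~-sym x~y)
        x≁v (≁-sym y≁w) (λ { refl → proj₁ (proj₂ mx) v∈ }) (λ { refl → proj₁ (proj₂ my) w∈ })

    -- Replacing `v` in `K` by `Q` gives a clique on at least |Q| + |K| - 1 vertices.
    clique-swap : ∀ {K Q v} → AllPairs _~_ K → AllPairs _~_ Q → All S K → All S Q →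
      (∀ {x w} → x ∈ Q → w ∈ K → w ≢ v → x ~ w) → length Q + length K ≤ suc m
    clique-swap {K} {Q} {v} cK cQ sK sQ cross = ≮⇒≥ λ big → no-clique
      ( Q ++ (K ∖ v)
      , s≤s⁻¹ (≤-trans big (≤-trans (+-monoʳ-≤ (length Q) (∖-length v cK))
          (≤-reflexive (trans (+-suc _ _) (cong suc (sym (length-++ Q)))))))
      , ++⁺ sQ (All.tabulate λ w∈ → All.lookup sK (proj₁ (∈-∖⁻ {K} w∈)))
      , AllPairs.++⁺ cQ (AllPairs.filter⁺ _ cK)
          (All.tabulate λ x∈ → All.tabulate λ w∈ → let w∈K , w≢v = ∈-∖⁻ {K} w∈ in cross x∈ w∈K w≢v))

    misses? : ∀ K x → Dec (Any (x ≁_) K)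
    misses? K x = Any.any? (λ w → ¬? (x ~? w)) K

    -- A vertex seeing all of `K` would extend it. Adjacent `x` and `y` miss the same `v` by
    -- `same-miss` and could together replace it, giving a clique on m + 1 vertices.
    Col-full-clique : ∀ {K} → AllPairs _~_ K → All S K → length K ≡ m → 3 ≤ m → Col (MissesAtMostOne K) 1
    Col-full-clique {K} cK sK refl 3≤ = Col-indep indep
      where
      missed : ∀ {x} → MissesAtMostOne K x → ∃ λ v → v ∈ K × x ≁ v
      missed {x} (sx , _) with misses? K x
      ... | yes a = find a
      ... | no ¬a = ⊥-elim (no-clique (x ∷ K , ≤-refl , sx ∷ sK ,
              All.map (λ {w} → decidable-stable (x ~? w)) (¬Any⇒All¬ K ¬a) ∷ cK))
      indep : ∀ {x y} → MissesAtMostOne K x → MissesAtMostOne K y → x ≁ y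
      indep {x} {y} mx my x~y with missed mx | missed my
      ... | v , v∈ , x≁v | w , w∈ , y≁w with same-miss cK 3≤ mx my x~y v∈ w∈ x≁v y≁w
      ... | refl = 1+n≰n (clique-swap {K} {x ∷ y ∷ []} {v} cK ((x~y ∷ []) ∷ [] ∷ []) sK
                     (proj₁ mx ∷ proj₁ my ∷ [])
                     λ { (here refl) w∈ w≢v → hits-others mx v∈ w∈ x≁v w≢v
                       ; (there (here refl)) w∈ w≢v → hits-others my v∈ w∈ y≁w w≢v })

    -- In the notation of the header, k is v_{j+1}, K is v_1, …, v_j, and L = m − j − 1.
    Col-peel : ∀ {k K L c} → AllPairs _~_ (k ∷ K) → All S (k ∷ K) → 3 ≤ length K →
      suc (L + length K) ≡ m → Col (MissesAtMostOne (k ∷ K)) c → Col (MissesAtMostOne K) (h (2 + L) + c)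
    Col-peel {k} {K} {L} {c} (kK ∷ cK) (sk ∷ sK) 3≤ len C =
      Col-split P? (Col-isolated k (h-pos L) isolate k≁F Col-F) (Col-mono shrink ≤-refl C)
      where
      P F : V → Set
      P x = x ≡ k ⊎ x ≁ k × Any (x ≁_) K
      F x = MissesAtMostOne K x × x ≁ k × Any (x ≁_) K
      P? : Decidable P
      P? x = (x ≟ k) ⊎-dec ¬? (x ~? k) ×-dec misses? K x
      isolate : ∀ {x} → MissesAtMostOne K x × P x → x ≡ k ⊎ F x
      isolate (mx , inj₁ e) = inj₁ e
      isolate (mx , inj₂ p) = inj₂ (mx , p)
      k≁F : ∀ {x} → F x → k ≁ x
      k≁F (_ , x≁k , _) = ≁-sym x≁k
      shrink : (MissesAtMostOne K ∩ ∁ P) ⊆ MissesAtMostOne (k ∷ K)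
      shrink {x} ((sx , x∉ , one) , ¬p) =
        sx , (λ { (here e) → ¬p (inj₁ e) ; (there i) → x∉ i }) , one′
        where
        one′ : ∀ {v w} → v ∈ k ∷ K → w ∈ k ∷ K → x ≁ v → x ≁ w → v ≡ w
        one′ (here refl) (here refl) _ _ = refl
        one′ (here refl) (there w∈) x≁k x≁w = ⊥-elim (¬p (inj₂ (x≁k , Any.map (λ { refl → x≁w }) w∈)))
        one′ (there v∈) (here refl) x≁v x≁k = ⊥-elim (¬p (inj₂ (x≁k , Any.map (λ { refl → x≁v }) v∈)))
        one′ (there v∈) (there w∈) x≁v x≁w = one v∈ w∈ x≁v x≁w
      -- The default `x` is never reached on `F`, where some vertex of `K` is missed.
      missed : V → V
      missed x with misses? K x
      ... | yes a = proj₁ (find a)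
      ... | no _ = x
      missed-spec : ∀ {x} → Any (x ≁_) K → missed x ∈ K × x ≁ missed x
      missed-spec {x} a with misses? K x
      ... | yes a′ = proj₂ (find a′)
      ... | no ¬a = ⊥-elim (¬a a)
      -- `h-bound` asks for a decidable set, so each fibre of `missed` on `F` is enlarged to this
      -- one.
      Class : V → V → Set
      Class v x = S x × x ≁ v × x ≁ k × All (λ w → w ≡ v ⊎ x ~ w) K
      class? : ∀ v → Decidable (Class v)
      class? v x = S? x ×-dec ¬? (x ~? v) ×-dec ¬? (x ~? k) ×-dec All.all? (λ w → (w ≟ v) ⊎-dec (x ~? w)) K
      F⇒Class : ∀ {v x} → F x × missed x ≡ v → Class v x
      F⇒Class {x = x} ((mx , x≁k , a) , refl) = let v∈ , x≁v = missed-spec a in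
        proj₁ mx , x≁v , x≁k , All.tabulate λ {w} w∈ →
          other w (w ≟ missed x) λ w≢v → hits-others mx v∈ w∈ x≁v w≢v
        where
        other : ∀ w {v} → Dec (w ≡ v) → (w ≢ v → x ~ w) → w ≡ v ⊎ x ~ w
        other w (yes e) _ = inj₁ e
        other w (no ¬e) f = inj₂ (f ¬e)
      Col-Class : ∀ v → v ∈ K → Col (Class v) (h (2 + L))
      Col-Class v v∈ = h-bound L (class? v)
        (no-matching-off-edge (All.lookup sK v∈) sk (~-sym (All.lookup kK v∈))
          λ (sx , x≁v , x≁k , _) → sx , ≁-sym x≁v , ≁-sym x≁k)
        -- `Q` could replace `v` in `K`, and |K| = m - L - 1, so |Q| is at most L + 2.
        λ (Q , big , inQ , cQ) → 1+n≰n (≤-trans (≤-trans (≤-reflexive (cong (2 +_) (sym len)))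
            (+-monoˡ-≤ (length K) big))
          (clique-swap {K} {Q} {v} cK cQ sK (All.map proj₁ inQ)
            λ x∈ w∈ w≢v → let _ , _ , _ , hits = All.lookup inQ x∈ in
              [ ⊥-elim ∘ w≢v , id ]′ (All.lookup hits w∈)))
      Col-F : Col F (h (2 + L))
      Col-F = Col-glue {D = _∈ K} missed (λ v → Any.any? (v ≟_) K) (λ (_ , _ , a) → proj₁ (missed-spec a))
        (λ (mx , _ , a) (my , _ , b) e →
          let v∈ , x≁v = missed-spec a ; w∈ , y≁w = missed-spec b in
          same-miss cK 3≤ mx my e v∈ w∈ x≁v y≁w)
        λ v v∈ → Col-mono F⇒Class ≤-refl (Col-Class v v∈)

    -- Here `a`, `b`, `c` are v_1, v_2, v_3. The vertices missing `a` and `b` go first, with no gain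
    -- in clique number. The remaining ones missing `a` and `c` all see `b`, so their clique number
    -- is at most m - 1; those then missing `b` and `c` all see `a`.
    Col-triple : ∀ {a b c r d} → AllPairs _~_ (a ∷ b ∷ c ∷ []) → All S (a ∷ b ∷ c ∷ []) → m ≡ 3 + r →
      Col (MissesAtMostOne (a ∷ b ∷ c ∷ [])) d → Col S (h (3 + r) + (h (2 + r) + (h (2 + r) + d)))
    Col-triple {a} {b} {c} {r} {d} ((a~b ∷ a~c ∷ []) ∷ (b~c ∷ []) ∷ [] ∷ []) (sa ∷ sb ∷ sc ∷ []) refl C =
      Col-split (off? b a)
        (Col-isolated b (h-pos (suc r)) split-off (λ (_ , p , _) → p) Col₁)
        (Col-split (off? a c)
          (Col-isolated a (h-pos r) split-off (λ (_ , p , _) → p) Col₂)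
          (Col-split (off? c b)
            (Col-isolated c (h-pos r) split-off (λ (_ , p , _) → p) Col₃)
            (Col-mono shrink ≤-refl C)))
      where
      Off : V → V → V → Set
      Off v w x = x ≡ v ⊎ v ≁ x × w ≁ x
      off? : ∀ v w → Decidable (Off v w)
      off? v w x = (x ≟ v) ⊎-dec ¬? (v ~? x) ×-dec ¬? (w ~? x)
      split-off : ∀ {X : Set} {v w x} → X × Off v w x → x ≡ v ⊎ (X × v ≁ x × w ≁ x)
      split-off (t , inj₁ e) = inj₁ e
      split-off (t , inj₂ p) = inj₂ (t , p)
      Col₁ : Col (λ x → S x × b ≁ x × a ≁ x) (h (3 + r))
      Col₁ = h-bound (suc r) (λ x → S? x ×-dec ¬? (b ~? x) ×-dec ¬? (a ~? x))
        (no-matching-off-edge sb sa (~-sym a~b) id)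
        λ (Q , big , inQ , cQ) → no-clique (Q , big , All.map proj₁ inQ , cQ)
      extend : ∀ {T v} → S v → T ⊆ S → (∀ {x} → T x → v ~ x) → ¬ Clique (3 + r) T
      extend {v = v} sv T⊆S v~T (Q , big , inQ , cQ) =
        no-clique (v ∷ Q , s≤s big , sv ∷ All.map T⊆S inQ , All.map v~T inQ ∷ cQ)
      Col₂ : Col (λ x → (S x × ¬ Off b a x) × a ≁ x × c ≁ x) (h (2 + r))
      Col₂ = h-bound r (λ x → (S? x ×-dec ¬? (off? b a x)) ×-dec ¬? (a ~? x) ×-dec ¬? (c ~? x))
        (no-matching-off-edge sa sc a~c λ ((s , _) , p) → s , p)
        (extend sb (proj₁ ∘ proj₁) λ {x} ((_ , ¬p) , a≁x , _) →
          decidable-stable (b ~? x) λ b≁x → ¬p (inj₂ (b≁x , a≁x)))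
      Col₃ : Col (λ x → ((S x × ¬ Off b a x) × ¬ Off a c x) × c ≁ x × b ≁ x) (h (2 + r))
      Col₃ = h-bound r
        (λ x → ((S? x ×-dec ¬? (off? b a x)) ×-dec ¬? (off? a c x)) ×-dec ¬? (c ~? x) ×-dec ¬? (b ~? x))
        (no-matching-off-edge sc sb (~-sym b~c) λ (((s , _) , _) , p) → s , p)
        (extend sa (proj₁ ∘ proj₁ ∘ proj₁) λ {x} ((_ , ¬p) , c≁x , _) →
          decidable-stable (a ~? x) λ a≁x → ¬p (inj₂ (a≁x , c≁x)))
      shrink : (((S ∩ ∁ (Off b a)) ∩ ∁ (Off a c)) ∩ ∁ (Off c b)) ⊆ MissesAtMostOne (a ∷ b ∷ c ∷ [])
      shrink {x} (((s , ¬ba) , ¬ac) , ¬cb) = s , x∉ , one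
        where
        x∉ : x ∉ a ∷ b ∷ c ∷ []
        x∉ (here e) = ¬ac (inj₁ e)
        x∉ (there (here e)) = ¬ba (inj₁ e)
        x∉ (there (there (here e))) = ¬cb (inj₁ e)
        ab : x ≁ a → x ≁ b → ⊥
        ab p q = ¬ba (inj₂ (≁-sym q , ≁-sym p))
        ac : x ≁ a → x ≁ c → ⊥
        ac p q = ¬ac (inj₂ (≁-sym p , ≁-sym q))
        bc : x ≁ b → x ≁ c → ⊥
        bc p q = ¬cb (inj₂ (≁-sym q , ≁-sym p))
        one : ∀ {v w} → v ∈ a ∷ b ∷ c ∷ [] → w ∈ a ∷ b ∷ c ∷ [] → x ≁ v → x ≁ w → v ≡ w
        one (here refl) (here refl) p q = refl
        one (here refl) (there (here refl)) p q = ⊥-elim (ab p q)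
        one (here refl) (there (there (here refl))) p q = ⊥-elim (ac p q)
        one (there (here refl)) (here refl) p q = ⊥-elim (ab q p)
        one (there (here refl)) (there (here refl)) p q = refl
        one (there (here refl)) (there (there (here refl))) p q = ⊥-elim (bc p q)
        one (there (there (here refl))) (here refl) p q = ⊥-elim (ac q p)
        one (there (there (here refl))) (there (here refl)) p q = ⊥-elim (bc q p)
        one (there (there (here refl))) (there (there (here refl))) p q = refl

    -- Invariant: `L` vertices have been dropped from a maximum clique. The final 1 in the colour
    -- count pays for the vertices missing one vertex of the full clique.
    descend : ∀ L K → AllPairs _~_ K → All S K → 3 ≤ length K → L + length K ≡ m →
      Col (MissesAtMostOne K) (sumFrom2 h (1 + L) + 1) → ∀ {r} → m ≡ 3 + r →
      Col S (sumFrom2 h (3 + r) + h (2 + r) + 1)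
    descend L (_ ∷ []) _ _ (s≤s ()) _ _ _
    descend L (_ ∷ _ ∷ []) _ _ (s≤s (s≤s ())) _ _ _
    descend L (a ∷ b ∷ c ∷ []) cK sK _ len C refl with +-cancelʳ-≡ 3 L _ (trans len (+-comm 3 _))
    ... | refl = Col-mono id (≤-reflexive (arith (sumFrom2 h (1 + L)) (h (2 + L)) (h (3 + L))))
                   (Col-triple cK sK refl C)
      where
      arith : ∀ s x y → y + (x + (x + (s + 1))) ≡ s + x + y + x + 1
      arith = solve-∀
    descend L (k ∷ K@(_ ∷ _ ∷ _ ∷ _)) cK@(_ ∷ cK′) sK@(_ ∷ sK′) _ len C =
      descend (suc L) K cK′ sK′ (s≤s (s≤s (s≤s z≤n))) len′
        (Col-mono id (≤-reflexive (arith (sumFrom2 h (1 + L)) (h (2 + L))))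
          (Col-peel cK sK (s≤s (s≤s (s≤s z≤n))) len′ C))
      where
      len′ : suc (L + length K) ≡ m
      len′ = trans (sym (+-suc L (length K))) len
      arith : ∀ s x → x + (s + 1) ≡ s + x + 1
      arith = solve-∀

    Col-step : ∀ {r} → m ≡ 3 + r → Clique m S → Col S (sumFrom2 h (3 + r) + h (2 + r) + 1)
    Col-step refl (K , m≤ , sK , cK) =
      descend 0 K cK sK (≤-trans (s≤s (s≤s (s≤s z≤n))) m≤) len
        (Col-full-clique cK sK len (s≤s (s≤s (s≤s z≤n)))) refl
      where
      len : length K ≡ m
      len = ≤-antisym (≮⇒≥ λ big → no-clique (K , big , sK , cK)) m≤

  -- Triangle-free sets

  module TriangleFree {S : V → Set} (S? : Decidable S) (no-clique : ¬ Clique 3 S) where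

    no-K₃ : ∀ {a b c} → S a → S b → S c → c ~ a → c ~ b → a ≁ b
    no-K₃ sa sb sc ca cb ab = no-clique
      (_ , ≤-refl , sc ∷ sa ∷ sb ∷ [] , (ca ∷ cb ∷ []) ∷ (ab ∷ []) ∷ [] ∷ [])

    Col-off-edge : ∀ {a b c} → S a → S b → Col (λ x → S x × a ≁ x × b ≁ x) c → Col S (2 + c)
    Col-off-edge {a} {b} sa sb C =
      Col-split (a ~?_) (Col-indep λ (sx , p) (sy , q) → no-K₃ sx sy sa p q)
        (Col-split (b ~?_) (Col-indep λ ((sx , _) , p) ((sy , _) , q) → no-K₃ sx sy sb p q)
          (Col-mono (λ ((sx , p) , q) → sx , p , q) ≤-refl C))

    Col-4 : ¬ InducedMatching 3 S → Col S 4
    Col-4 no-matching = record { col = k ; bounded = b ; proper = p }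
      where
      -- `True (S? x)` is proof-irrelevant, so `search` over `W` reduces to a search over `V`.
      W : Set
      W = Σ V λ x → True (S? x)
      in-S : (w : W) → S (proj₁ w)
      in-S (_ , s) = toWitness s
      search : ∀ {P : W → Set} → Decidable P → Dec (∃ P)
      search {P} P? = map′ (λ (x , s , p) → (x , s) , p) (λ ((x , s) , p) → x , s , p) (any? at)
        where
        at : ∀ x → Dec (Σ (True (S? x)) λ s → P (x , s))
        at x with T? (isYes (S? x))
        ... | no ¬s = no (¬s ∘ proj₁)
        ... | yes s = map′ (s ,_) (λ (s′ , p) → subst (λ s → P (x , s)) (T-irrelevant s′ s) p) (P? (x , s))
      open TriangleFree3K₂Free {W} (λ a b → proj₁ a ~ proj₁ b) ~-sym (λ a b → proj₁ a ~? proj₁ b) search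
        (λ {a} {b} {c} → no-K₃ (in-S a) (in-S b) (in-S c)) using (Colouring; four-colouring)
      colouring : Colouring
      colouring = four-colouring λ {a} {b} {c} {d} {e} {f} ab cd ef
          (ac , ad , bc , bd) (ae , af , be , bf) (ce , cf , de , df) → no-matching
        ( _ , _ , in-S a , in-S b , ab
        , _ , _ , (in-S c , ac , bc) , (in-S d , ad , bd) , cd
        , _ , _ , ((in-S e , ae , be) , ce , de) , ((in-S f , af , bf) , cf , df) , ef , tt)
      k : V → ℕ
      k x with T? (isYes (S? x))
      ... | yes s = toℕ (proj₁ colouring (x , s))
      ... | no _ = 0
      b : ∀ {x} → S x → k x < 4
      b {x} _ with T? (isYes (S? x))
      ... | yes s = toℕ<n _
      ... | no _ = s≤s z≤n
      p : ∀ {x y} → S x → S y → x ~ y → k x ≢ k y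
      p {x} {y} sx sy e with T? (isYes (S? x)) | T? (isYes (S? y))
      ... | yes s | yes t = proj₂ colouring e ∘ toℕ-injective
      ... | no ¬s | _ = ⊥-elim (¬s (fromWitness sx))
      ... | yes _ | no ¬t = ⊥-elim (¬t (fromWitness sy))

  edge? : {S : V → Set} → Decidable S → Dec (∃₂ λ a b → S a × S b × a ~ b)
  edge? S? = any? λ a → any? λ b → S? a ×-dec S? b ×-dec (a ~? b)

  -- For q = 0 the part off an edge is independent, so 2 + 1 colours do; q = 1 is the 4-colouring;
  -- each further K₂ costs two colours.
  Col-triangle-free : ∀ q {S} → Decidable S → ¬ InducedMatching (2 + q) S → ¬ Clique 3 S →
    Col S (f (2 + q) 2)
  Col-triangle-free q S? nm nc with edge? S?
  Col-triangle-free zero S? nm nc | no ¬e =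
    Col-mono id (s≤s z≤n) (Col-indep λ s t e → ¬e (_ , _ , s , t , e))
  Col-triangle-free (suc q) S? nm nc | no ¬e =
    Col-mono id (s≤s z≤n) (Col-indep λ s t e → ¬e (_ , _ , s , t , e))
  Col-triangle-free zero S? nm nc | yes (a , b , sa , sb , e) = TriangleFree.Col-off-edge S? nc sa sb
    (Col-indep λ s t e′ → nm (_ , _ , sa , sb , e , _ , _ , s , t , e′ , tt))
  Col-triangle-free (suc zero) S? nm nc | yes _ = TriangleFree.Col-4 S? nc nm
  Col-triangle-free (suc (suc q)) S? nm nc | yes (a , b , sa , sb , e) =
    Col-mono id (≤-reflexive (arith q)) (TriangleFree.Col-off-edge S? nc sa sb
      (Col-triangle-free (suc q) (λ x → S? x ×-dec ¬? (a ~? x) ×-dec ¬? (b ~? x))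
        (λ m → nm (a , b , sa , sb , e , m))
        λ (Q , big , inQ , cQ) → nc (Q , big , All.map proj₁ inQ , cQ)))
    where
    arith : ∀ q → 3 + (q + (3 + q + 0)) ≡ 2 + q + (4 + q + 0)
    arith = solve-∀

  -- The induction on p and the clique number

  by-clique : ∀ q r {S} → Decidable S → (Clique (3 + r) S → Col S (f (2 + q) (3 + r))) →
    (¬ Clique (3 + r) S → Col S (f (2 + q) (2 + r))) → Col S (f (2 + q) (3 + r))
  by-clique q r S? large small with clique? (3 + r) S?
  ... | yes K = large K
  ... | no ¬K = Col-mono id (f-mono q r) (small ¬K)

  module _ (no-wheel : WheelFree) where

    -- The classes of a step go to the previous `q` at various clique numbers; a set without a
    -- clique of size `m` goes to the previous `m` at the same `q`.
    Col-f : ∀ q m {S} → Decidable S → ¬ InducedMatching (2 + q) S → ¬ Clique (1 + m) S → Col S (f (2 + q) m)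
    Col-f q zero {S} S? nm nc = record
      { col = λ _ → 0 ; bounded = ⊥-elim ∘ empty ; proper = λ s _ _ _ → empty s }
      where
      empty : ∀ {x} → ¬ S x
      empty s = nc (_ ∷ [] , ≤-refl , s ∷ [] , [] ∷ [])
    Col-f q (suc zero) {S} S? nm nc = Col-mono id (one q) (Col-indep indep)
      where
      one : ∀ q → 1 ≤ f (2 + q) 1
      one zero = ≤-refl
      one (suc q) = ≤-refl
      indep : ∀ {x y} → S x → S y → x ≁ y
      indep s t e = nc (_ , ≤-refl , s ∷ t ∷ [] , (e ∷ []) ∷ [] ∷ [])
    Col-f q (suc (suc zero)) S? nm nc = Col-triangle-free q S? nm nc
    -- At p = 2 the classes span no edge and take one colour each. Hence `h` is constantly 1,
    -- whereas `f 1` is 0 by convention.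
    Col-f zero (suc m@(suc (suc r))) S? nm nc = by-clique zero r S?
      (λ K → Col-mono id (≤-reflexive (arith r)) (Step.Col-step no-wheel S? nm nc (λ _ → 1) (λ _ → ≤-refl)
        (λ _ _ no-edge _ → Col-indep λ s t e → no-edge (_ , _ , s , t , e , tt)) refl K))
      (Col-f zero m S? nm)
      where
      arith : ∀ r → sumFrom2 (λ _ → 1) (3 + r) + 1 + 1 ≡ 3 + r + 1
      arith r = trans (cong (λ k → k + 1 + 1) (sumFrom2-const (2 + r))) (cong (_+ 1) (+-comm (2 + r) 1))
    Col-f (suc q) (suc m@(suc (suc r))) S? nm nc = by-clique (suc q) r S?
      (Step.Col-step no-wheel S? nm nc (f (2 + q)) (f-pos q) (λ t → Col-f q (2 + t)) refl)
      (Col-f (suc q) m S? nm)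

  -- Translation to induced subgraphs, cliques and colourings of the graph

  K₁+C₄-free⇒WheelFree : ¬ InducedSub K1+C4 G → WheelFree
  K₁+C₄-free⇒WheelFree K₁+C₄-free {h} {a} {b} {c} {d} ha hb hc hd ab bc cd da a≁c b≁d a≢c b≢d =
    K₁+C₄-free (φ , inj , hom)
    where
    φ : Fin 5 → V
    φ = λ { 0F → h ; 1F → a ; 2F → b ; 3F → c ; 4F → d }
    hom : ∀ i j → adj G (φ i) (φ j) ≡ adj K1+C4 i j
    hom 0F 0F = irrefl G h
    hom 0F 1F = ha
    hom 0F 2F = hb
    hom 0F 3F = hc
    hom 0F 4F = hd
    hom 1F 0F = ~-sym ha
    hom 1F 1F = irrefl G a
    hom 1F 2F = ab
    hom 1F 3F = ¬-not a≁c
    hom 1F 4F = ~-sym da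
    hom 2F 0F = ~-sym hb
    hom 2F 1F = ~-sym ab
    hom 2F 2F = irrefl G b
    hom 2F 3F = bc
    hom 2F 4F = ¬-not b≁d
    hom 3F 0F = ~-sym hc
    hom 3F 1F = ¬-not (≁-sym a≁c)
    hom 3F 2F = ~-sym bc
    hom 3F 3F = irrefl G c
    hom 3F 4F = cd
    hom 4F 0F = ~-sym hd
    hom 4F 1F = da
    hom 4F 2F = ¬-not (≁-sym b≁d)
    hom 4F 3F = ~-sym cd
    hom 4F 4F = irrefl G d
    -- Adjacent images differ by irreflexivity; the two diagonals of the 4-cycle call for `a≢c` and
    -- `b≢d`.
    distinct : ∀ i j → i ≡ j ⊎ adj K1+C4 i j ≡ true ⊎ φ i ≢ φ j
    distinct 0F 0F = inj₁ refl
    distinct 0F (suc _) = inj₂ (inj₁ refl)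
    distinct (suc _) 0F = inj₂ (inj₁ refl)
    distinct 1F 1F = inj₁ refl
    distinct 1F 2F = inj₂ (inj₁ refl)
    distinct 1F 3F = inj₂ (inj₂ a≢c)
    distinct 1F 4F = inj₂ (inj₁ refl)
    distinct 2F 1F = inj₂ (inj₁ refl)
    distinct 2F 2F = inj₁ refl
    distinct 2F 3F = inj₂ (inj₁ refl)
    distinct 2F 4F = inj₂ (inj₂ b≢d)
    distinct 3F 1F = inj₂ (inj₂ (a≢c ∘ sym))
    distinct 3F 2F = inj₂ (inj₁ refl)
    distinct 3F 3F = inj₁ refl
    distinct 3F 4F = inj₂ (inj₁ refl)
    distinct 4F 1F = inj₂ (inj₁ refl)
    distinct 4F 2F = inj₂ (inj₂ (b≢d ∘ sym))
    distinct 4F 3F = inj₂ (inj₁ refl)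
    distinct 4F 4F = inj₁ refl
    inj : ∀ {i j} → φ i ≡ φ j → i ≡ j
    inj {i} {j} eq with distinct i j
    ... | inj₁ p = p
    ... | inj₂ (inj₁ p) = ⊥-elim (~⇒≢ (trans (hom i j) p) eq)
    ... | inj₂ (inj₂ p) = ⊥-elim (p eq)

  clique⇒HasClique : ∀ {k S} → Clique k S → HasClique G k
  clique⇒HasClique (xs , k≤ , _ , cxs) =
    φ , (λ {i} {j} eq → decidable-stable (i ≟ j) λ i≢j → ~⇒≢ (edge i j i≢j) eq) , edge
    where
    φ : Fin _ → V
    φ i = lookup xs (inject≤ i k≤)
    lookup-edge : ∀ {xs} → AllPairs _~_ xs → ∀ i j → i ≢ j → lookup xs i ~ lookup xs j
    lookup-edge (p ∷ c) zero zero i≢j = ⊥-elim (i≢j refl)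
    lookup-edge {x ∷ xs} (p ∷ c) zero (suc j) _ = All.lookup p (∈-lookup j)
    lookup-edge {x ∷ xs} (p ∷ c) (suc i) zero _ = ~-sym (All.lookup p (∈-lookup i))
    lookup-edge (p ∷ c) (suc i) (suc j) i≢j = lookup-edge c i j (i≢j ∘ cong suc)
    edge : ∀ i j → i ≢ j → φ i ~ φ j
    edge i j i≢j = lookup-edge cxs _ _ (i≢j ∘ inject≤-injective k≤ k≤ i j)

  -- The images are kept inside `S` because one level down, membership includes missing both ends of
  -- the new edge.
  matching⇒pK₂ : ∀ {p S} → InducedMatching p S →
    Σ (InducedSub (pK2 p) G) λ (φ , _) → ∀ e → S (φ e)
  matching⇒pK₂ {zero} _ = ((λ ()) , (λ {e} → λ { {()} }) , λ ()) , λ ()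
  matching⇒pK₂ {suc p} {S} (a , b , sa , sb , a~b , m) with matching⇒pK₂ {p} m
  ... | (φ , φ-inj , hom) , in-S = (ψ , ψ-inj , hom′) , in-S′
    where
    ψ : Fin (suc p) × Bool → V
    ψ (zero , false) = a
    ψ (zero , true) = b
    ψ (suc i , x) = φ (i , x)
    in-S′ : ∀ e → S (ψ e)
    in-S′ (zero , false) = sa
    in-S′ (zero , true) = sb
    in-S′ (suc i , x) = proj₁ (in-S (i , x))
    away : ∀ x e → ψ (zero , x) ≁ φ e
    away false e = proj₁ (proj₂ (in-S e))
    away true e = proj₂ (proj₂ (in-S e))
    -- If one end of the new edge were `φ e`, the other end would see `φ e`, against `away`.
    fresh : ∀ x e → ψ (zero , x) ≢ φ e
    fresh false e eq = away true e (subst (b ~_) eq (~-sym a~b))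
    fresh true e eq = away false e (subst (a ~_) eq a~b)
    ψ-inj : ∀ {e e′} → ψ e ≡ ψ e′ → e ≡ e′
    ψ-inj {zero , false} {zero , false} _ = refl
    ψ-inj {zero , false} {zero , true} eq = ⊥-elim (~⇒≢ a~b eq)
    ψ-inj {zero , true} {zero , false} eq = ⊥-elim (~⇒≢ a~b (sym eq))
    ψ-inj {zero , true} {zero , true} _ = refl
    ψ-inj {zero , x} {suc j , y} eq = ⊥-elim (fresh x (j , y) eq)
    ψ-inj {suc i , x} {zero , y} eq = ⊥-elim (fresh y (i , x) (sym eq))
    ψ-inj {suc i , x} {suc j , y} eq with refl ← φ-inj eq = refl
    hom′ : ∀ e e′ → adj G (ψ e) (ψ e′) ≡ adj (pK2 (suc p)) e e′
    hom′ (zero , false) (zero , false) = irrefl G a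
    hom′ (zero , false) (zero , true) = a~b
    hom′ (zero , true) (zero , false) = ~-sym a~b
    hom′ (zero , true) (zero , true) = irrefl G b
    hom′ (zero , x) (suc j , y) = ¬-not (away x (j , y))
    hom′ (suc i , x) (zero , y) = ¬-not (≁-sym (away y (i , x)))
    hom′ (suc i , x) (suc j , y) = hom (i , x) (j , y)

  Col⇒Colorable : ∀ {c} → Col (λ _ → ⊤) c → Colorable G c
  Col⇒Colorable C = (λ x → fromℕ< (bounded C {x} tt)) , λ x y e same →
    proper C tt tt e (fromℕ<-injective _ _ _ _ same)

theorem3p11 : (p : ℕ) → 2 ≤ p → (n : ℕ) → (G : FinGraph n) →
    ¬ InducedSub (pK2 p) G → ¬ InducedSub K1+C4 G →
    (w : ℕ) → IsCliqueNumber G w → Colorable G (f p w)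
theorem3p11 (suc (suc q)) (s≤s (s≤s z≤n)) n G pK₂-free K₁+C₄-free w (_ , no-clique) =
  Col⇒Colorable (Col-f (K₁+C₄-free⇒WheelFree K₁+C₄-free) q w (λ _ → yes tt)
    (pK₂-free ∘ proj₁ ∘ matching⇒pK₂) (no-clique ∘ clique⇒HasClique))
  where open Colouring-bounds G
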